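{- For every integer $L\geq 4$, the following coefficientwise inequality of formal power series in $q$ holds: $$ \frac{1}{(q;q^2)_L}\left(\frac{1-q^{2L-2}}{1-q^2}+q^3\genfrac{[}{]}{0pt}{}{L-2}{2}_{q^2}\right)\ \succeq\ q\,\genfrac{[}{]}{0pt}{}{L-2}{2}_{q}\,(-q^3;q)_{L-4}. $$
   Context: The $q$-Pochhammer symbol is $(a;q)_N=\prod_{j=0}^{N-1}(1-aq^j)$ for integers $N\ge 0$, with $(a;q)_0=1$; in particular $(q;q^2)_N=\prod_{j=0}^{N-1}(1-q^{2j+1})$ and $(-q^3;q)_N=\prod_{j=0}^{N-1}(1+q^{3+j})$. The Gaussian polynomial is $\genfrac{[}{]}{0pt}{}{m}{n}_{q}=\frac{(q;q)_m}{(q;q)_n(q;q)_{m-n}}$ for integers $m\ge n\ge 0$, and it equals $0$ otherwise; $\genfrac{[}{]}{0pt}{}{m}{n}_{q^2}$ denotes the same polynomial with $q$ replaced by $q^2$. Reciprocals are expanded as formal power series in $q$. For formal power series $A(q),B(q)$ in $q$, $A(q)\succeq B(q)$ means that every coefficient of $A(q)-B(q)$ is nonnegative. -}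

module Defs where

open import Level using (0ℓ)
open import Data.Bool using (if_then_else_)
open import Data.Nat as ℕ using (ℕ; zero; suc; _∸_; _≤ᵇ_)
open import Data.Integer as ℤ using (ℤ; 0ℤ; 1ℤ)
open import Data.Fin using (toℕ)
open import Algebra.Bundles.Raw using (RawRing)
open import Algebra.Definitions.RawMonoid ℤ.+-0-rawMonoid using (sum)
open import Relation.Binary.PropositionalEquality using (_≡_)
import Algebra.Definitions.RawSemiring as RawSemiringDefs

-- ℤ⟦q⟧: a series is its sequence of coefficients, with A n the coefficient of qⁿ.
Series : Set
Series = ℕ → ℤ

constant : ℤ → Series
constant c zero    = c
constant c (suc _) = 0ℤ

seriesRawRing : RawRing 0ℓ 0ℓ
seriesRawRing = record
  { Carrier = Series
  ; _≈_     = λ A B → ∀ n → A n ≡ B n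
  ; _+_     = λ A B n → A n ℤ.+ B n
  ; _*_     = λ A B n → sum {suc n} (λ k → A (toℕ k) ℤ.* B (n ∸ toℕ k))
  ; -_      = λ A n → ℤ.- A n
  ; 0#      = constant 0ℤ
  ; 1#      = constant 1ℤ
  }

open RawRing seriesRawRing public
  using (_≈_; _+_; _*_; -_; 0#; 1#)
open RawSemiringDefs (RawRing.rawSemiring seriesRawRing) public
  using (_^_; product)

infixl 6 _-_
_-_ : Series → Series → Series
A - B = A + (- B)

q : Series
q 1 = 1ℤ
q _ = 0ℤ

-- The inverse of a series with constant term 1 (the only case used), as the
-- geometric series 1/A = Σₖ (1 - A)ᵏ.  Since (1 - A)ᵏ is divisible by qᵏ, only
-- the terms with k ≤ n contribute to the coefficient of qⁿ.
recip : Series → Series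
recip A n = sum {suc n} (λ k → ((1# - A) ^ toℕ k) n)

infixl 7 _/_
_/_ : Series → Series → Series
A / B = A * recip B

-- The base b is itself a series, so that pochhammer q (q ^ 2) N is (q;q²)_N.
pochhammer : (a b : Series) → ℕ → Series
pochhammer a b N = product {N} (λ j → 1# - a * b ^ toℕ j)

-- The Gaussian polynomial [m, n] in the base b.  Here b must have zero constant
-- term, so that the denominator has constant term 1.
gaussian : (b : Series) → ℕ → ℕ → Series
gaussian b m n =
  if n ≤ᵇ m
  then pochhammer b b m / (pochhammer b b n * pochhammer b b (m ∸ n))
  else 0#

infix 4 _⪰_
_⪰_ : Series → Series → Set
A ⪰ B = ∀ n → 0ℤ ℤ.≤ (A - B) n

{-# OPTIONS --safe #-}
module Submission where

-- Write R = 1/(q;q²)_L, S = (1-q^(2L-2))/(1-q²), E = (-q;q)_{L-4} and let G and H be the Gaussian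
-- polynomials [L-2, 2] in the bases q² and q.  Cancelling common factors, H (-q³;q)_{L-4} = G E, so
--     LHS - RHS = R (S + (q³ - q) G) + q G (R - E).
-- Here R ⪰ E because 1/(q;q²)_n = (-q;q)_n / (q^(n+1);q)_n.  For the other term, one of L-2 and L-3
-- is even, say 2p; then with Q = q² and K = 1 + Q² + ... + Q^(2p-2)
--     S + (q³ - q) G = K (1 - q) + (a polynomial with nonnegative coefficients),
-- and R contains the factor 1/(1 - q), which absorbs 1 - q.

open import Level using (0ℓ)
open import Data.Nat as ℕ using (ℕ; zero; suc; _∸_)
import Data.Nat.Properties as ℕ
open import Data.Integer as ℤ using (ℤ; 0ℤ; 1ℤ)
import Data.Integer.Properties as ℤ
open import Data.Fin using (Fin; toℕ)
open import Data.Nat.DivMod using (_divMod_; result)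
open import Data.Maybe using (Maybe; just; nothing)
open import Data.Product using (_,_)
open import Function using (_∘_)
open import Relation.Binary.PropositionalEquality as ≡ using (_≡_)
open import Relation.Nullary.Decidable using (yes; no)
open import Algebra.Bundles using (CommutativeMonoid; CommutativeRing; Monoid; Semiring)
open import Algebra.Definitions.RawMonoid ℤ.+-0-rawMonoid using (sum)
import Algebra.Definitions.RawMonoid as RawMonoidDefs
import Algebra.Definitions.RawSemiring as RawSemiringDefs
import Algebra.Solver.Ring
import Algebra.Solver.Ring.AlmostCommutativeRing as ACR
import Algebra.Properties.CommutativeSemigroup as CommutativeSemigroupProperties
import Algebra.Properties.Semiring.Exp
import Relation.Binary.Reasoning.Setoid

-- Finite sums and products, and identities in an abstract commutative ring

-- `sum` and `product` recurse on the first index, whereas geometric sums and Pochhammer products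
-- grow at the last. An arbitrary monoid covers both cases.
sum-toℕ-suc : ∀ {c ℓ} (M : Monoid c ℓ) (f : ℕ → Monoid.Carrier M) n →
  Monoid._≈_ M (RawMonoidDefs.sum (Monoid.rawMonoid M) {suc n} (f ∘ toℕ))
               (Monoid._∙_ M (RawMonoidDefs.sum (Monoid.rawMonoid M) {n} (f ∘ toℕ)) (f n))
sum-toℕ-suc M f zero    = M.trans (M.identityʳ (f 0)) (M.sym (M.identityˡ (f 0)))
  where module M = Monoid M
sum-toℕ-suc M f (suc n) = M.trans (M.∙-congˡ (sum-toℕ-suc M (f ∘ suc) n)) (M.sym (M.assoc _ _ _))
  where module M = Monoid M

-- The ring is abstract because over Series the solver would unfold every Cauchy product.
module Identities {c ℓ} (R : CommutativeRing c ℓ)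
  (φ : CommutativeRing.rawRing ℤ.+-*-commutativeRing
         ACR.-Raw-AlmostCommutative⟶ ACR.fromCommutativeRing R) where

  open CommutativeRing R
  open Semiring semiring using (rawSemiring)
  open RawSemiringDefs rawSemiring using (_^_; product)
  open Algebra.Properties.Semiring.Exp semiring using (^-homo-*; ^-assocʳ)
  open Relation.Binary.Reasoning.Setoid setoid

  private module φ = ACR._-Raw-AlmostCommutative⟶_ φ

  -- φ, changed so that ⟦ 0ℤ ⟧ and ⟦ 1ℤ ⟧ compute, as the solver requires of con 0ℤ and con 1ℤ.
  ⟦_⟧ : ℤ → Carrier
  ⟦ ℤ.+ 0 ⟧ = 0#
  ⟦ ℤ.+ 1 ⟧ = 1#
  ⟦ i     ⟧ = φ.⟦ i ⟧

  ⟦⟧≈φ : ∀ i → ⟦ i ⟧ ≈ φ.⟦ i ⟧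
  ⟦⟧≈φ (ℤ.+ 0)             = sym φ.0-homo
  ⟦⟧≈φ (ℤ.+ 1)             = sym φ.1-homo
  ⟦⟧≈φ (ℤ.+ suc (suc _))   = refl
  ⟦⟧≈φ ℤ.-[1+ _ ]          = refl

  ⟦⟧-morphism : CommutativeRing.rawRing ℤ.+-*-commutativeRing
    ACR.-Raw-AlmostCommutative⟶ ACR.fromCommutativeRing R
  ⟦⟧-morphism = record
    { ⟦_⟧    = ⟦_⟧
    ; +-homo = λ i j → trans (⟦⟧≈φ (i ℤ.+ j)) (trans (φ.+-homo i j) (sym (+-cong (⟦⟧≈φ i) (⟦⟧≈φ j))))
    ; *-homo = λ i j → trans (⟦⟧≈φ (i ℤ.* j)) (trans (φ.*-homo i j) (sym (*-cong (⟦⟧≈φ i) (⟦⟧≈φ j))))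
    ; -‿homo = λ i → trans (⟦⟧≈φ (ℤ.- i)) (trans (φ.-‿homo i) (sym (-‿cong (⟦⟧≈φ i))))
    ; 0-homo = refl
    ; 1-homo = refl
    }

  ⟦⟧-≟ : ∀ i j → Maybe (⟦ i ⟧ ≈ ⟦ j ⟧)
  ⟦⟧-≟ i j with i ℤ.≟ j
  ... | yes ≡.refl = just refl
  ... | no _       = nothing

  open Algebra.Solver.Ring (CommutativeRing.rawRing ℤ.+-*-commutativeRing)
    (ACR.fromCommutativeRing R) ⟦⟧-morphism ⟦⟧-≟ public
    using (solve; _:=_; _:+_; _:*_; _:-_; :-_; con)

  -- Cancellation stands in for division, which an abstract ring lacks.
  Regular : Carrier → Set _
  Regular a = ∀ x y → x * a ≈ y * a → x ≈ y

  1-cong : ∀ {x y} → x ≈ y → 1# - x ≈ 1# - y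
  1-cong x≈y = +-congˡ (-‿cong x≈y)

  product-cong : ∀ N {f g : Fin N → Carrier} → (∀ k → f k ≈ g k) → product f ≈ product g
  product-cong zero    f≈g = refl
  product-cong (suc N) f≈g = *-cong (f≈g Fin.zero) (product-cong N (f≈g ∘ Fin.suc))

  poch : (a b : Carrier) → ℕ → Carrier
  poch a b N = product {N} (λ j → 1# - a * b ^ toℕ j)

  poch-congˡ : ∀ {a a′} b N → a ≈ a′ → poch a b N ≈ poch a′ b N
  poch-congˡ b N a≈a′ = product-cong N (λ _ → 1-cong (*-congʳ a≈a′))

  poch-sucʳ : ∀ a b N → poch a b (suc N) ≈ poch a b N * (1# - a * b ^ N)
  poch-sucʳ a b N = sum-toℕ-suc *-monoid (λ k → 1# - a * b ^ k) N

  poch-sucˡ : ∀ a b N → poch a b (suc N) ≈ (1# - a) * poch (a * b) b N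
  poch-sucˡ a b N = *-cong (1-cong (*-identityʳ a))
    (product-cong N (λ _ → 1-cong (sym (*-assoc a b _))))

  ^-double : ∀ b n → (b ^ 2) ^ n ≈ b ^ n * b ^ n
  ^-double b n = begin
    (b ^ 2) ^ n      ≈⟨ ^-assocʳ b 2 n ⟩
    b ^ (2 ℕ.* n)    ≡⟨ ≡.cong (λ k → b ^ (n ℕ.+ k)) (ℕ.+-identityʳ n) ⟩
    b ^ (n ℕ.+ n)    ≈⟨ ^-homo-* b n n ⟩
    b ^ n * b ^ n    ∎

  -- Euler's theorem on partitions into distinct and into odd parts, with finitely many factors.
  distinct*odd : ∀ b → (∀ n → Regular (1# - b ^ suc n)) →
    ∀ n → poch (- b) b n * poch b (b ^ 2) n ≈ poch (b ^ suc n) b n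
  distinct*odd b reg zero    = *-identityˡ 1#
  -- With x = b^n, the product starting at b^(n+1) loses its first factor 1 - bx and gains 1 - bx²
  -- and 1 - b²x² at the end. Multiplying by 1 - bx restores the lost factor, and (1 + bx)(1 - bx)
  -- gives the last new one.
  distinct*odd b reg (suc n) = reg n _ _ (begin
    poch (- b) b (suc n) * poch b (b ^ 2) (suc n) * (1# - b * x)
      ≈⟨ *-congʳ (*-cong (poch-sucʳ (- b) b n)
           (trans (poch-sucʳ b (b ^ 2) n) (*-congˡ (1-cong (*-congˡ (^-double b n)))))) ⟩
    E * (1# - - b * x) * (O * (1# - b * (x * x))) * (1# - b * x)
      ≈⟨ solve 4 (λ b x E O →
           E :* (con 1ℤ :- :- b :* x) :* (O :* (con 1ℤ :- b :* (x :* x))) :* (con 1ℤ :- b :* x)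
           := E :* O :* (con 1ℤ :- b :* x :* x) :* (con 1ℤ :- b :* x :* (b :* x))) refl b x E O ⟩
    E * O * (1# - b * x * x) * (1# - b * x * (b * x))
      ≈⟨ *-congʳ (*-congʳ (distinct*odd b reg n)) ⟩
    poch (b * x) b n * (1# - b * x * x) * (1# - b * x * (b * x))
      ≈⟨ *-congʳ (poch-sucʳ (b * x) b n) ⟨
    poch (b * x) b (suc n) * (1# - b * x * (b * x))
      ≈⟨ poch-sucʳ (b * x) b (suc n) ⟨
    poch (b * x) b (suc (suc n))
      ≈⟨ poch-sucˡ (b * x) b (suc n) ⟩
    (1# - b * x) * poch (b * x * b) b (suc n)
      ≈⟨ *-congˡ (poch-congˡ b (suc n) (*-comm (b * x) b)) ⟩
    (1# - b * x) * poch (b * (b * x)) b (suc n)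
      ≈⟨ *-comm _ _ ⟩
    poch (b * (b * x)) b (suc n) * (1# - b * x)  ∎)
    where
    x = b ^ n
    E = poch (- b) b n
    O = poch b (b ^ 2) n

  -- Gaussian polynomials with lower index 2

  -- The formula for [n+2, 2] in base `b` after cancelling (b;b)_n and clearing the remaining
  -- denominator.
  Gaussian-2 : Carrier → ℕ → Carrier → Set _
  Gaussian-2 b n G = G * ((1# - b) * (1# - b ^ 2)) ≈ (1# - b ^ suc n) * (1# - b ^ suc (suc n))

  quotient⇒Gaussian-2 : ∀ {b n G} → Regular (poch b b n) →
    G * (poch b b 2 * poch b b n) ≈ poch b b (2 ℕ.+ n) → Gaussian-2 b n G
  quotient⇒Gaussian-2 {b} {n} {G} reg G-quotient = reg _ _ (begin
    G * ((1# - b) * (1# - b ^ 2)) * P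
      ≈⟨ solve 3 (λ G b P →
           G :* ((con 1ℤ :- b) :* (con 1ℤ :- b :* (b :* con 1ℤ))) :* P
           := G :* ((con 1ℤ :- b :* con 1ℤ) :* ((con 1ℤ :- b :* (b :* con 1ℤ)) :* con 1ℤ) :* P))
           refl G b P ⟩
    G * (poch b b 2 * P)
      ≈⟨ G-quotient ⟩
    poch b b (2 ℕ.+ n)
      ≈⟨ poch-sucʳ b b (suc n) ⟩
    poch b b (suc n) * (1# - b ^ suc (suc n))
      ≈⟨ *-congʳ (poch-sucʳ b b n) ⟩
    P * (1# - b ^ suc n) * (1# - b ^ suc (suc n))
      ≈⟨ solve 3 (λ P u v → P :* u :* v := u :* v :* P) refl P _ _ ⟩
    (1# - b ^ suc n) * (1# - b ^ suc (suc n)) * P  ∎)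
    where P = poch b b n

  -- Both sides are (-b;b)_(n+2), with either its first two or its last two factors split off.
  distinct-from-3 : ∀ b n → poch (- (b ^ 3)) b n * ((1# + b) * (1# + b ^ 2))
                          ≈ poch (- b) b n * ((1# + b ^ suc n) * (1# + b ^ suc (suc n)))
  distinct-from-3 b n = begin
    poch (- (b ^ 3)) b n * ((1# + b) * (1# + b ^ 2))
      ≈⟨ *-congʳ (poch-congˡ b n
           (solve 1 (λ b → :- (b :* (b :* (b :* con 1ℤ))) := :- b :* b :* b) refl b)) ⟩
    P₃ * ((1# + b) * (1# + b ^ 2))
      ≈⟨ solve 2 (λ b P → P :* ((con 1ℤ :+ b) :* (con 1ℤ :+ b :* (b :* con 1ℤ)))
           := (con 1ℤ :- :- b) :* ((con 1ℤ :- :- b :* b) :* P)) refl b P₃ ⟩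
    (1# - - b) * ((1# - - b * b) * P₃)
      ≈⟨ *-congˡ (poch-sucˡ (- b * b) b n) ⟨
    (1# - - b) * poch (- b * b) b (suc n)
      ≈⟨ poch-sucˡ (- b) b (suc n) ⟨
    poch (- b) b (2 ℕ.+ n)
      ≈⟨ poch-sucʳ (- b) b (suc n) ⟩
    poch (- b) b (suc n) * (1# - - b * b ^ suc n)
      ≈⟨ *-congʳ (poch-sucʳ (- b) b n) ⟩
    P * (1# - - b * b ^ n) * (1# - - b * b ^ suc n)
      ≈⟨ solve 3 (λ b x P → P :* (con 1ℤ :- :- b :* x) :* (con 1ℤ :- :- b :* (b :* x))
           := P :* ((con 1ℤ :+ b :* x) :* (con 1ℤ :+ b :* (b :* x)))) refl b (b ^ n) P ⟩
    P * ((1# + b ^ suc n) * (1# + b ^ suc (suc n)))  ∎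
    where
    P  = poch (- b) b n
    P₃ = poch (- b * b * b) b n

  -- Differences of squares turn every 1 - b^k of `H` into the 1 - b^(2k) of `G`. The factors 1 +
  -- b^k required for this, in numerator and denominator, are those exchanged by `distinct-from-3`.
  gaussian*distinct : ∀ {b n H G} → Regular ((1# - b ^ 2) * (1# - (b ^ 2) ^ 2)) →
    Gaussian-2 b n H → Gaussian-2 (b ^ 2) n G →
    H * poch (- (b ^ 3)) b n ≈ G * poch (- b) b n
  gaussian*distinct {b} {n} {H} {G} reg H-gaussian G-gaussian = reg _ _ (begin
    H * P₃ * D
      ≈⟨ solve 3 (λ b H P →
           H :* P :* ((con 1ℤ :- b :* (b :* con 1ℤ))
                      :* (con 1ℤ :- (b :* (b :* con 1ℤ)) :* ((b :* (b :* con 1ℤ)) :* con 1ℤ)))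
           := (H :* ((con 1ℤ :- b) :* (con 1ℤ :- b :* (b :* con 1ℤ))))
              :* (P :* ((con 1ℤ :+ b) :* (con 1ℤ :+ b :* (b :* con 1ℤ)))))
           refl b H P₃ ⟩
    (H * ((1# - b) * (1# - b ^ 2))) * (P₃ * ((1# + b) * (1# + b ^ 2)))
      ≈⟨ *-cong H-gaussian (distinct-from-3 b n) ⟩
    (1# - u) * (1# - v) * (E * ((1# + u) * (1# + v)))
      ≈⟨ solve 3 (λ u v E → (con 1ℤ :- u) :* (con 1ℤ :- v) :* (E :* ((con 1ℤ :+ u) :* (con 1ℤ :+ v)))
           := (con 1ℤ :- u :* u) :* (con 1ℤ :- v :* v) :* E) refl u v E ⟩
    (1# - u * u) * (1# - v * v) * E
      ≈⟨ *-congʳ (*-cong (1-cong (^-double b (suc n))) (1-cong (^-double b (suc (suc n))))) ⟨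
    (1# - (b ^ 2) ^ suc n) * (1# - (b ^ 2) ^ suc (suc n)) * E
      ≈⟨ *-congʳ G-gaussian ⟨
    G * D * E
      ≈⟨ solve 3 (λ G D E → G :* D :* E := G :* E :* D) refl G D E ⟩
    G * E * D  ∎)
    where
    u  = b ^ suc n
    v  = b ^ suc (suc n)
    D  = (1# - b ^ 2) * (1# - (b ^ 2) ^ 2)
    E  = poch (- b) b n
    P₃ = poch (- (b ^ 3)) b n

  -- Each denominator factor is paired with one numerator factor that it divides. In the application
  -- `z` is a power of Q² and `w` a power of Q, so `K` and `B` are geometric sums.
  gaussian-factors : ∀ {Q z w G K B} → Regular ((1# - Q) * (1# - Q ^ 2)) →
    G * ((1# - Q) * (1# - Q ^ 2)) ≈ (1# - z) * (1# - w) →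
    (1# - Q ^ 2) * K ≈ 1# - z → (1# - Q) * B ≈ 1# - w → G ≈ K * B
  gaussian-factors {Q} {z} {w} {G} {K} {B} reg G-eq K-eq B-eq = reg _ _ (begin
    G * ((1# - Q) * (1# - Q ^ 2))    ≈⟨ G-eq ⟩
    (1# - z) * (1# - w)              ≈⟨ *-cong K-eq B-eq ⟨
    (1# - Q ^ 2) * K * ((1# - Q) * B)
      ≈⟨ solve 4 (λ c d K B → d :* K :* (c :* B) := K :* B :* (c :* d)) refl _ _ K B ⟩
    K * B * ((1# - Q) * (1# - Q ^ 2))  ∎)

  -- Splitting the bracket and the difference of the two sides

  -- Cancelling 1 - Q gives S = K(1 + Q) + Z, while (q³ - q)G = -q(1 - Q)BK = -qK + qwK. The only
  -- negative term, -qK, pairs with the K of S to form K(1 - q).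
  bracket-decomposition : ∀ {q z w S G K B Z} (let Q = q ^ 2) → Regular (1# - Q) →
    S * (1# - Q) ≈ (1# - z) + (1# - Q) * Z →
    G ≈ K * B → (1# - Q ^ 2) * K ≈ 1# - z → (1# - Q) * B ≈ 1# - w →
    (S + q ^ 3 * G) - q * G ≈ K * (1# - q) + (K * Q + Z + q * w * K)
  bracket-decomposition {q} {z} {w} {S} {G} {K} {B} {Z} reg S-eq G≈KB K-eq B-eq = begin
    (S + q ^ 3 * G) - q * G
      ≈⟨ +-cong (+-cong S≈ (*-congˡ G≈KB)) (-‿cong (*-congˡ G≈KB)) ⟩
    (K * (1# + Q) + Z + q ^ 3 * (K * B)) - q * (K * B)
      ≈⟨ solve 4 (λ q K B Z → let Q = q :* (q :* con 1ℤ) in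
           (K :* (con 1ℤ :+ Q) :+ Z :+ q :* Q :* (K :* B)) :- q :* (K :* B)
           := K :* (con 1ℤ :- q)
              :+ (K :* Q :+ Z :+ q :* (con 1ℤ :- (con 1ℤ :- Q) :* B) :* K)) refl q K B Z ⟩
    K * (1# - q) + (K * Q + Z + q * (1# - (1# - Q) * B) * K)
      ≈⟨ +-congˡ (+-congˡ (*-congʳ (*-congˡ (trans (1-cong B-eq) 1-[1-w]≈w)))) ⟩
    K * (1# - q) + (K * Q + Z + q * w * K)  ∎
    where
    Q = q ^ 2

    1-[1-w]≈w : 1# - (1# - w) ≈ w
    1-[1-w]≈w = solve 1 (λ w → con 1ℤ :- (con 1ℤ :- w) := w) refl w

    S≈ : S ≈ K * (1# + Q) + Z
    S≈ = reg _ _ (begin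
      S * (1# - Q)                       ≈⟨ S-eq ⟩
      (1# - z) + (1# - Q) * Z            ≈⟨ +-congʳ K-eq ⟨
      (1# - Q ^ 2) * K + (1# - Q) * Z
        ≈⟨ solve 3 (λ Q K Z → (con 1ℤ :- Q :* (Q :* con 1ℤ)) :* K :+ (con 1ℤ :- Q) :* Z
             := (K :* (con 1ℤ :+ Q) :+ Z) :* (con 1ℤ :- Q)) refl Q K Z ⟩
      (K * (1# + Q) + Z) * (1# - Q)      ∎)

  -- With x = Q, this and the next identity treat the numerator of S when its exponent exceeds that
  -- of `z` by one or by two. The excess becomes the term `Z` of `bracket-decomposition`.
  1-xz-expansion : ∀ x z → 1# - x * z ≈ (1# - z) + (1# - x) * z
  1-xz-expansion = solve 2 (λ x z → con 1ℤ :- x :* z := (con 1ℤ :- z) :+ (con 1ℤ :- x) :* z) refl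

  1-xxz-expansion : ∀ x z → 1# - x * (x * z) ≈ (1# - z) + (1# - x) * ((1# + x) * z)
  1-xxz-expansion = solve 2 (λ x z → con 1ℤ :- x :* (x :* z)
    := (con 1ℤ :- z) :+ (con 1ℤ :- x) :* ((con 1ℤ :+ x) :* z)) refl

  -- Replacing HP by GE gives both sides the common factor `G`. Adding and subtracting qGR then
  -- isolates the bracket, and `R` is grouped with 1 - q so that it can absorb it.
  difference-decomposition : ∀ {q R S G H P E K V} → H * P ≈ G * E →
    (S + q ^ 3 * G) - q * G ≈ K * (1# - q) + V →
    R * (S + q ^ 3 * G) - q * H * P ≈ K * (R * (1# - q)) + R * V + q * G * (R - E)
  difference-decomposition {q} {R} {S} {G} {H} {P} {E} {K} {V} HP≈GE bracket = begin
    R * (S + q ^ 3 * G) - q * H * P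
      ≈⟨ +-congˡ (-‿cong (trans (*-assoc q H P) (*-congˡ HP≈GE))) ⟩
    R * (S + q ^ 3 * G) - q * (G * E)
      ≈⟨ solve 5 (λ q R T G E → R :* T :- q :* (G :* E) := R :* (T :- q :* G) :+ q :* G :* (R :- E))
           refl q R _ G E ⟩
    R * ((S + q ^ 3 * G) - q * G) + q * G * (R - E)
      ≈⟨ +-congʳ (*-congˡ bracket) ⟩
    R * (K * (1# - q) + V) + q * G * (R - E)
      ≈⟨ +-congʳ (solve 4 (λ R K c V → R :* (K :* c :+ V) := K :* (R :* c) :+ R :* V) refl R K _ V) ⟩
    K * (R * (1# - q)) + R * V + q * G * (R - E)  ∎

open import Defs

-- The commutative ring of formal power series

private
  module +ℤ = CommutativeSemigroupProperties
    (CommutativeMonoid.commutativeSemigroup ℤ.+-0-commutativeMonoid)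

-- By computation, `(A * B) (suc n)` is `A 0 ℤ.* B (suc n) ℤ.+ (tail A * B) n`. The ring laws below
-- are inductions along this recursion.
tail : Series → Series
tail A = A ∘ suc

scale : ℤ → Series → Series
scale c A n = c ℤ.* A n

-- A coefficient of a product sees only the coefficients of its factors up to the same degree, which
-- allows series to be replaced by truncations.
*-cong-≤ : ∀ n {A A′ B B′ : Series} →
  (∀ k → k ℕ.≤ n → A k ≡ A′ k) → (∀ k → k ℕ.≤ n → B k ≡ B′ k) → (A * B) n ≡ (A′ * B′) n
*-cong-≤ zero    a b = ≡.cong (ℤ._+ 0ℤ) (≡.cong₂ ℤ._*_ (a 0 ℕ.z≤n) (b 0 ℕ.z≤n))
*-cong-≤ (suc n) a b = ≡.cong₂ ℤ._+_
  (≡.cong₂ ℤ._*_ (a 0 ℕ.z≤n) (b (suc n) ℕ.≤-refl))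
  (*-cong-≤ n (λ k k≤n → a (suc k) (ℕ.s≤s k≤n)) (λ k k≤n → b k (ℕ.m≤n⇒m≤1+n k≤n)))

*-congˢ : ∀ {A A′ B B′} → A ≈ A′ → B ≈ B′ → A * B ≈ A′ * B′
*-congˢ a b n = *-cong-≤ n (λ k _ → a k) (λ k _ → b k)

-- The mirror image of the defining recursion; comparing the two yields commutativity.
*-sucʳ : ∀ A B n → (A * B) (suc n) ≡ A (suc n) ℤ.* B 0 ℤ.+ (A * tail B) n
*-sucʳ A B zero = begin
  A 0 ℤ.* B 1 ℤ.+ (A 1 ℤ.* B 0 ℤ.+ 0ℤ)  ≡⟨ +ℤ.x∙yz≈y∙xz (A 0 ℤ.* B 1) (A 1 ℤ.* B 0) 0ℤ ⟩
  A 1 ℤ.* B 0 ℤ.+ (A 0 ℤ.* B 1 ℤ.+ 0ℤ)  ∎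
  where open ≡.≡-Reasoning
*-sucʳ A B (suc n) = begin
  A 0 ℤ.* B (2 ℕ.+ n) ℤ.+ (tail A * B) (suc n)
    ≡⟨ ≡.cong (ℤ._+_ (A 0 ℤ.* B (2 ℕ.+ n))) (*-sucʳ (tail A) B n) ⟩
  A 0 ℤ.* B (2 ℕ.+ n) ℤ.+ (A (2 ℕ.+ n) ℤ.* B 0 ℤ.+ (tail A * tail B) n)
    ≡⟨ +ℤ.x∙yz≈y∙xz (A 0 ℤ.* B (2 ℕ.+ n)) (A (2 ℕ.+ n) ℤ.* B 0) _ ⟩
  A (2 ℕ.+ n) ℤ.* B 0 ℤ.+ (A * tail B) (suc n)  ∎
  where open ≡.≡-Reasoning

*-commˢ : ∀ A B → A * B ≈ B * A
*-commˢ A B zero    = ≡.cong (ℤ._+ 0ℤ) (ℤ.*-comm (A 0) (B 0))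
*-commˢ A B (suc n) = begin
  A 0 ℤ.* B (suc n) ℤ.+ (tail A * B) n
    ≡⟨ ≡.cong₂ ℤ._+_ (ℤ.*-comm (A 0) (B (suc n))) (*-commˢ (tail A) B n) ⟩
  B (suc n) ℤ.* A 0 ℤ.+ (B * tail A) n  ≡⟨ *-sucʳ B A n ⟨
  (B * A) (suc n)                       ∎
  where open ≡.≡-Reasoning

*-distribʳ-+ˢ : ∀ C A B → (A + B) * C ≈ A * C + B * C
*-distribʳ-+ˢ C A B zero = begin
  (A 0 ℤ.+ B 0) ℤ.* C 0 ℤ.+ 0ℤ                   ≡⟨ ℤ.+-identityʳ _ ⟩
  (A 0 ℤ.+ B 0) ℤ.* C 0                          ≡⟨ ℤ.*-distribʳ-+ (C 0) (A 0) (B 0) ⟩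
  A 0 ℤ.* C 0 ℤ.+ B 0 ℤ.* C 0                    ≡⟨ ≡.cong₂ ℤ._+_ (ℤ.+-identityʳ (A 0 ℤ.* C 0)) (ℤ.+-identityʳ (B 0 ℤ.* C 0)) ⟨
  A 0 ℤ.* C 0 ℤ.+ 0ℤ ℤ.+ (B 0 ℤ.* C 0 ℤ.+ 0ℤ)  ∎
  where open ≡.≡-Reasoning
*-distribʳ-+ˢ C A B (suc n) = begin
  (A 0 ℤ.+ B 0) ℤ.* C (suc n) ℤ.+ ((tail A + tail B) * C) n
    ≡⟨ ≡.cong₂ ℤ._+_ (ℤ.*-distribʳ-+ (C (suc n)) (A 0) (B 0)) (*-distribʳ-+ˢ C (tail A) (tail B) n) ⟩
  (A 0 ℤ.* C (suc n) ℤ.+ B 0 ℤ.* C (suc n)) ℤ.+ ((tail A * C) n ℤ.+ (tail B * C) n)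
    ≡⟨ +ℤ.interchange (A 0 ℤ.* C (suc n)) (B 0 ℤ.* C (suc n)) _ _ ⟩
  (A * C + B * C) (suc n)  ∎
  where open ≡.≡-Reasoning

*-distribˡ-+ˢ : ∀ C A B → C * (A + B) ≈ C * A + C * B
*-distribˡ-+ˢ C A B n = begin
  (C * (A + B)) n    ≡⟨ *-commˢ C (A + B) n ⟩
  ((A + B) * C) n    ≡⟨ *-distribʳ-+ˢ C A B n ⟩
  (A * C + B * C) n  ≡⟨ ≡.cong₂ ℤ._+_ (*-commˢ A C n) (*-commˢ B C n) ⟩
  (C * A + C * B) n  ∎
  where open ≡.≡-Reasoning

scale-* : ∀ c A B → scale c A * B ≈ scale c (A * B)
scale-* c A B zero = begin
  c ℤ.* A 0 ℤ.* B 0 ℤ.+ 0ℤ    ≡⟨ ℤ.+-identityʳ _ ⟩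
  c ℤ.* A 0 ℤ.* B 0            ≡⟨ ℤ.*-assoc c (A 0) (B 0) ⟩
  c ℤ.* (A 0 ℤ.* B 0)          ≡⟨ ≡.cong (c ℤ.*_) (ℤ.+-identityʳ _) ⟨
  c ℤ.* (A 0 ℤ.* B 0 ℤ.+ 0ℤ)  ∎
  where open ≡.≡-Reasoning
scale-* c A B (suc n) = begin
  c ℤ.* A 0 ℤ.* B (suc n) ℤ.+ (scale c (tail A) * B) n
    ≡⟨ ≡.cong₂ ℤ._+_ (ℤ.*-assoc c (A 0) (B (suc n))) (scale-* c (tail A) B n) ⟩
  c ℤ.* (A 0 ℤ.* B (suc n)) ℤ.+ c ℤ.* (tail A * B) n
    ≡⟨ ℤ.*-distribˡ-+ c (A 0 ℤ.* B (suc n)) _ ⟨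
  c ℤ.* (A * B) (suc n)  ∎
  where open ≡.≡-Reasoning

*-assocˢ : ∀ A B C → (A * B) * C ≈ A * (B * C)
*-assocˢ A B C zero = begin
  (A 0 ℤ.* B 0 ℤ.+ 0ℤ) ℤ.* C 0 ℤ.+ 0ℤ  ≡⟨ ≡.cong (λ x → x ℤ.* C 0 ℤ.+ 0ℤ) (ℤ.+-identityʳ (A 0 ℤ.* B 0)) ⟩
  A 0 ℤ.* B 0 ℤ.* C 0 ℤ.+ 0ℤ            ≡⟨ ≡.cong (ℤ._+ 0ℤ) (ℤ.*-assoc (A 0) (B 0) (C 0)) ⟩
  A 0 ℤ.* (B 0 ℤ.* C 0) ℤ.+ 0ℤ          ≡⟨ ≡.cong (λ x → A 0 ℤ.* x ℤ.+ 0ℤ) (ℤ.+-identityʳ (B 0 ℤ.* C 0)) ⟨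
  A 0 ℤ.* (B 0 ℤ.* C 0 ℤ.+ 0ℤ) ℤ.+ 0ℤ  ∎
  where open ≡.≡-Reasoning
*-assocˢ A B C (suc n) = begin
  -- By computation, the tail of `A * B` is `scale (A 0) (tail B) + tail A * B`.
  (A * B) 0 ℤ.* C (suc n) ℤ.+ ((scale (A 0) (tail B) + tail A * B) * C) n
    ≡⟨ ≡.cong₂ ℤ._+_ (≡.cong (ℤ._* C (suc n)) (ℤ.+-identityʳ (A 0 ℤ.* B 0)))
                     (*-distribʳ-+ˢ C (scale (A 0) (tail B)) (tail A * B) n) ⟩
  A 0 ℤ.* B 0 ℤ.* C (suc n) ℤ.+ ((scale (A 0) (tail B) * C) n ℤ.+ ((tail A * B) * C) n)
    ≡⟨ ≡.cong₂ ℤ._+_ (ℤ.*-assoc (A 0) (B 0) (C (suc n)))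
         (≡.cong₂ ℤ._+_ (scale-* (A 0) (tail B) C n) (*-assocˢ (tail A) B C n)) ⟩
  A 0 ℤ.* (B 0 ℤ.* C (suc n)) ℤ.+ (A 0 ℤ.* (tail B * C) n ℤ.+ (tail A * (B * C)) n)
    ≡⟨ ℤ.+-assoc (A 0 ℤ.* (B 0 ℤ.* C (suc n))) _ _ ⟨
  A 0 ℤ.* (B 0 ℤ.* C (suc n)) ℤ.+ A 0 ℤ.* (tail B * C) n ℤ.+ (tail A * (B * C)) n
    ≡⟨ ≡.cong (ℤ._+ (tail A * (B * C)) n) (ℤ.*-distribˡ-+ (A 0) (B 0 ℤ.* C (suc n)) _) ⟨
  (A * (B * C)) (suc n)  ∎
  where open ≡.≡-Reasoning

-- The zero series appears as a constant function because that is what `tail (constant c)` computes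
-- to.
zero-* : ∀ B n → ((λ _ → 0ℤ) * B) n ≡ 0ℤ
zero-* B zero    = ≡.refl
zero-* B (suc n) = ≡.trans (ℤ.+-identityˡ _) (zero-* B n)

constant-* : ∀ c B → constant c * B ≈ scale c B
constant-* c B zero    = ℤ.+-identityʳ _
constant-* c B (suc n) =
  ≡.trans (≡.cong (ℤ._+_ (c ℤ.* B (suc n))) (zero-* B n)) (ℤ.+-identityʳ _)

*-identityˡˢ : ∀ A → 1# * A ≈ A
*-identityˡˢ A n = ≡.trans (constant-* 1ℤ A n) (ℤ.*-identityˡ (A n))

0#-coefficient : ∀ n → 0# n ≡ 0ℤ
0#-coefficient zero    = ≡.refl
0#-coefficient (suc _) = ≡.refl

seriesRing : CommutativeRing 0ℓ 0ℓ
seriesRing = record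
  { Carrier = Series ; _≈_ = _≈_ ; _+_ = _+_ ; _*_ = _*_ ; -_ = -_ ; 0# = 0# ; 1# = 1#
  ; isCommutativeRing = record
    { isRing = record
      { +-isAbelianGroup = record
        { isGroup = record
          { isMonoid = record
            { isSemigroup = record
              { isMagma = record
                { isEquivalence = record
                  { refl  = λ _ → ≡.refl
                  ; sym   = λ A≈B n → ≡.sym (A≈B n)
                  ; trans = λ A≈B B≈C n → ≡.trans (A≈B n) (B≈C n)
                  }
                ; ∙-cong = λ A≈A′ B≈B′ n → ≡.cong₂ ℤ._+_ (A≈A′ n) (B≈B′ n)
                }
              ; assoc = λ A B C n → ℤ.+-assoc (A n) (B n) (C n)
              }
            ; identity =
                (λ A n → ≡.trans (≡.cong (ℤ._+ A n) (0#-coefficient n)) (ℤ.+-identityˡ (A n)))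
              , (λ A n → ≡.trans (≡.cong (ℤ._+_ (A n)) (0#-coefficient n)) (ℤ.+-identityʳ (A n)))
            }
          ; inverse =
              (λ A n → ≡.trans (ℤ.+-inverseˡ (A n)) (≡.sym (0#-coefficient n)))
            , (λ A n → ≡.trans (ℤ.+-inverseʳ (A n)) (≡.sym (0#-coefficient n)))
          ; ⁻¹-cong = λ A≈B n → ≡.cong ℤ.-_ (A≈B n)
          }
        ; comm = λ A B n → ℤ.+-comm (A n) (B n)
        }
      ; *-cong     = *-congˢ
      ; *-assoc    = *-assocˢ
      ; *-identity = *-identityˡˢ , λ A n → ≡.trans (*-commˢ A 1# n) (*-identityˡˢ A n)
      ; distrib    = *-distribˡ-+ˢ , *-distribʳ-+ˢ
      }
    ; *-comm = *-commˢ
    }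
  }

open CommutativeRing seriesRing
  using (setoid; semiring; refl; sym; trans; +-congʳ; distribˡ;
         *-cong; *-congˡ; *-congʳ; *-comm; *-assoc; *-identityˡ; *-identityʳ)
open Relation.Binary.Reasoning.Setoid setoid
open Algebra.Properties.Semiring.Exp semiring using (^-assocʳ; ^-congʳ)

constant-morphism : CommutativeRing.rawRing ℤ.+-*-commutativeRing
  ACR.-Raw-AlmostCommutative⟶ ACR.fromCommutativeRing seriesRing
constant-morphism = record
  { ⟦_⟧    = constant
  ; +-homo = λ { a b zero → ≡.refl ; a b (suc n) → ≡.refl }
  ; *-homo = λ { a b zero → ≡.sym (ℤ.+-identityʳ _)
               ; a b (suc n) → ≡.sym (≡.trans (constant-* a (constant b) (suc n)) (ℤ.*-zeroʳ a)) }
  ; -‿homo = λ { a zero → ≡.refl ; a (suc n) → ≡.refl }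
  ; 0-homo = refl
  ; 1-homo = refl
  }

open Identities seriesRing constant-morphism

-- Geometric sums and reciprocals

-- Summed coefficientwise, so that `recip A n` is by definition `geometric (1# - A) (suc n) n`.
geometric : Series → ℕ → Series
geometric b N n = sum {N} (λ k → (b ^ toℕ k) n)

geometric-suc : ∀ b N → geometric b (suc N) ≈ geometric b N + b ^ N
geometric-suc b N n = sum-toℕ-suc ℤ.+-0-monoid (λ k → (b ^ k) n) N

[1-b]*geometric : ∀ b N → (1# - b) * geometric b N ≈ 1# - b ^ N
[1-b]*geometric b zero = begin
  (1# - b) * geometric b 0  ≈⟨ *-congˡ {1# - b} (λ n → ≡.sym (0#-coefficient n)) ⟩
  (1# - b) * 0#             ≈⟨ solve 1 (λ b → (con 1ℤ :- b) :* con 0ℤ := con 1ℤ :- con 1ℤ) refl b ⟩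
  1# - 1#                   ∎
[1-b]*geometric b (suc N) = begin
  (1# - b) * geometric b (suc N)                     ≈⟨ *-congˡ {1# - b} (geometric-suc b N) ⟩
  (1# - b) * (geometric b N + b ^ N)                 ≈⟨ distribˡ (1# - b) (geometric b N) (b ^ N) ⟩
  (1# - b) * geometric b N + (1# - b) * b ^ N        ≈⟨ +-congʳ ([1-b]*geometric b N) ⟩
  (1# - b ^ N) + (1# - b) * b ^ N
    ≈⟨ solve 2 (λ b x → (con 1ℤ :- x) :+ (con 1ℤ :- b) :* x := con 1ℤ :- b :* x) refl b (b ^ N) ⟩
  1# - b ^ suc N                                     ∎

-- If q divides U, then q^k divides U^k.
^-low-coefficient : ∀ U → U 0 ≡ 0ℤ → ∀ {k n} → n ℕ.< k → (U ^ k) n ≡ 0ℤ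
^-low-coefficient U U₀ {suc k} {zero}  _           =
  ≡.trans (ℤ.+-identityʳ (U 0 ℤ.* (U ^ k) 0))
    (≡.trans (≡.cong (ℤ._* (U ^ k) 0) U₀) (ℤ.*-zeroˡ ((U ^ k) 0)))
^-low-coefficient U U₀ {suc k} {suc n} (ℕ.s≤s n<k) = ≡.cong₂ ℤ._+_ low high
  where
  low : U 0 ℤ.* (U ^ k) (suc n) ≡ 0ℤ
  low = ≡.trans (≡.cong (ℤ._* (U ^ k) (suc n)) U₀) (ℤ.*-zeroˡ ((U ^ k) (suc n)))

  high : (tail U * U ^ k) n ≡ 0ℤ
  high = ≡.trans
    (*-cong-≤ n {A = tail U} (λ _ _ → ≡.refl)
      (λ j j≤n → ^-low-coefficient U U₀ (ℕ.≤-<-trans j≤n n<k)))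
    (≡.trans (*-comm (tail U) (λ _ → 0ℤ) n) (zero-* (tail U) n))

geometric-stable : ∀ U → U 0 ≡ 0ℤ → ∀ {k n} → k ℕ.≤ n →
  geometric U (suc k) k ≡ geometric U (suc n) k
geometric-stable U U₀ {k} k≤n = go (ℕ.≤⇒≤′ k≤n)
  where
  go : ∀ {n} → k ℕ.≤′ n → geometric U (suc k) k ≡ geometric U (suc n) k
  go ℕ.≤′-refl             = ≡.refl
  go (ℕ.≤′-step {n} k≤′n) = ≡.trans (go k≤′n) (≡.sym (≡.trans (geometric-suc U (suc n) k)
    (≡.trans (≡.cong (ℤ._+_ (geometric U (suc n) k))
                     (^-low-coefficient U U₀ (ℕ.s≤s (ℕ.≤′⇒≤ k≤′n))))
             (ℤ.+-identityʳ _))))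

-- The truncation in `recip` varies with the coefficient. For the coefficient of q^n, all
-- truncations are extended to the same n + 1 terms; the product then telescopes to 1 - U^(n+1),
-- whose power of U does not reach degree n.
recip-inverseʳ : ∀ {A} → A 0 ≡ 1ℤ → A * recip A ≈ 1#
recip-inverseʳ {A} A₀ n = ≡.trans
  (*-cong-≤ n {A = A} (λ _ _ → ≡.refl) (λ k → geometric-stable U U₀))
  (≡.trans (A*geometric n)
    (≡.trans (≡.cong (λ x → 1# n ℤ.+ ℤ.- x) (^-low-coefficient U U₀ (ℕ.≤-refl {suc n})))
      (ℤ.+-identityʳ _)))
  where
  U : Series
  U = 1# - A

  U₀ : U 0 ≡ 0ℤ
  U₀ = ≡.cong (λ x → 1ℤ ℤ.+ ℤ.- x) A₀

  A*geometric : A * geometric U (suc n) ≈ 1# - U ^ suc n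
  A*geometric = begin
    A * geometric U (suc n)
      ≈⟨ *-congʳ {geometric U (suc n)} (solve 1 (λ a → a := con 1ℤ :- (con 1ℤ :- a)) refl A) ⟩
    (1# - U) * geometric U (suc n)  ≈⟨ [1-b]*geometric U (suc n) ⟩
    1# - U ^ suc n                  ∎

*-constant : ∀ {A B} → A 0 ≡ 1ℤ → B 0 ≡ 1ℤ → (A * B) 0 ≡ 1ℤ
*-constant A₀ B₀ = ≡.cong (ℤ._+ 0ℤ) (≡.cong₂ ℤ._*_ A₀ B₀)

*-≈⇒≈-/ : ∀ {A B} X → A 0 ≡ 1ℤ → X * A ≈ B → X ≈ B / A
*-≈⇒≈-/ {A} {B} X A₀ XA≈B = begin
  X                    ≈⟨ *-identityʳ X ⟨
  X * 1#               ≈⟨ *-congˡ {X} (recip-inverseʳ {A} A₀) ⟨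
  X * (A * recip A)    ≈⟨ *-assoc X A (recip A) ⟨
  X * A * recip A      ≈⟨ *-congʳ {recip A} XA≈B ⟩
  B / A                ∎

/-*-cancel : ∀ {A} B → A 0 ≡ 1ℤ → B / A * A ≈ B
/-*-cancel {A} B A₀ = begin
  B * recip A * A    ≈⟨ solve 3 (λ a b r → b :* r :* a := b :* (a :* r)) refl A B (recip A) ⟩
  B * (A * recip A)  ≈⟨ *-congˡ {B} (recip-inverseʳ {A} A₀) ⟩
  B * 1#             ≈⟨ *-identityʳ B ⟩
  B                  ∎

*-cancelʳ : ∀ {A} X Y → A 0 ≡ 1ℤ → X * A ≈ Y * A → X ≈ Y
*-cancelʳ {A} X Y A₀ XA≈YA = begin
  X            ≈⟨ *-≈⇒≈-/ {A} X A₀ XA≈YA ⟩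
  Y * A / A    ≈⟨ *-≈⇒≈-/ {A} Y A₀ (refl {Y * A}) ⟨
  Y            ∎

recip-* : ∀ {A B} → A 0 ≡ 1ℤ → B 0 ≡ 1ℤ → recip (A * B) ≈ recip A * recip B
recip-* {A} {B} A₀ B₀ = begin
  recip (A * B)       ≈⟨ *-identityˡ (recip (A * B)) ⟨
  1# / (A * B)        ≈⟨ *-≈⇒≈-/ {A * B} (recip A * recip B) (*-constant {A} {B} A₀ B₀) inverse ⟨
  recip A * recip B   ∎
  where
  inverse : recip A * recip B * (A * B) ≈ 1#
  inverse = begin
    recip A * recip B * (A * B)
      ≈⟨ solve 4 (λ a b r s → r :* s :* (a :* b) := (a :* r) :* (b :* s)) refl A B (recip A) (recip B) ⟩
    (A * recip A) * (B * recip B)  ≈⟨ *-cong (recip-inverseʳ {A} A₀) (recip-inverseʳ {B} B₀) ⟩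
    1# * 1#                        ≈⟨ *-identityˡ 1# ⟩
    1#                             ∎

-- Series with nonnegative coefficients

NonNegative : Series → Set
NonNegative A = ∀ n → 0ℤ ℤ.≤ A n

nonNegative-resp-≈ : ∀ {A B} → A ≈ B → NonNegative A → NonNegative B
nonNegative-resp-≈ A≈B A≥0 n = ≡.subst (0ℤ ℤ.≤_) (A≈B n) (A≥0 n)

+-nonNegative : ∀ {A B} → NonNegative A → NonNegative B → NonNegative (A + B)
+-nonNegative A≥0 B≥0 n = ℤ.+-mono-≤ (A≥0 n) (B≥0 n)

ℤ-*-nonNegative : ∀ {i j} → 0ℤ ℤ.≤ i → 0ℤ ℤ.≤ j → 0ℤ ℤ.≤ i ℤ.* j
ℤ-*-nonNegative {i} {j} i≥0 j≥0 =
  ≡.subst (ℤ._≤ i ℤ.* j) (ℤ.*-zeroʳ i) (ℤ.*-monoˡ-≤-nonNeg i {{ℤ.nonNegative i≥0}} j≥0)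

*-nonNegative : ∀ {A B} → NonNegative A → NonNegative B → NonNegative (A * B)
*-nonNegative A≥0 B≥0 zero    = ℤ.+-mono-≤ (ℤ-*-nonNegative (A≥0 0) (B≥0 0)) ℤ.≤-refl
*-nonNegative A≥0 B≥0 (suc n) = ℤ.+-mono-≤ (ℤ-*-nonNegative (A≥0 0) (B≥0 (suc n)))
  (*-nonNegative (A≥0 ∘ suc) B≥0 n)

1-nonNegative : NonNegative 1#
1-nonNegative zero    = ℤ.+≤+ ℕ.z≤n
1-nonNegative (suc _) = ℤ.≤-refl

^-nonNegative : ∀ {A} k → NonNegative A → NonNegative (A ^ k)
^-nonNegative zero    A≥0 = 1-nonNegative
^-nonNegative (suc k) A≥0 = *-nonNegative A≥0 (^-nonNegative k A≥0)

sum-nonNegative : ∀ N {f : Fin N → ℤ} → (∀ k → 0ℤ ℤ.≤ f k) → 0ℤ ℤ.≤ sum f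
sum-nonNegative zero    f≥0 = ℤ.≤-refl
sum-nonNegative (suc N) f≥0 = ℤ.+-mono-≤ (f≥0 Fin.zero) (sum-nonNegative N (f≥0 ∘ Fin.suc))

product-nonNegative : ∀ {N} {f : Fin N → Series} → (∀ k → NonNegative (f k)) →
  NonNegative (product f)
product-nonNegative {zero}  f≥0 = 1-nonNegative
product-nonNegative {suc N} f≥0 =
  *-nonNegative (f≥0 Fin.zero) (product-nonNegative (f≥0 ∘ Fin.suc))

geometric-nonNegative : ∀ {b} N → NonNegative b → NonNegative (geometric b N)
geometric-nonNegative N b≥0 n = sum-nonNegative N (λ k → ^-nonNegative (toℕ k) b≥0 n)

q-nonNegative : NonNegative q
q-nonNegative 0             = ℤ.≤-refl
q-nonNegative 1             = ℤ.+≤+ ℕ.z≤n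
q-nonNegative (suc (suc _)) = ℤ.≤-refl

-- The constant term is carried along because `recip-inverseʳ` and `recip-*` require it.
record NonNegativeReciprocal (A : Series) : Set where
  constructor _,_
  field
    constant≡1        : A 0 ≡ 1ℤ
    recip-nonNegative : NonNegative (recip A)

open NonNegativeReciprocal

*-nonNegativeReciprocal : ∀ {A B} → NonNegativeReciprocal A → NonNegativeReciprocal B →
  NonNegativeReciprocal (A * B)
*-nonNegativeReciprocal {A} {B} (A₀ , 1/A≥0) (B₀ , 1/B≥0) =
  *-constant {A} {B} A₀ B₀ ,
  nonNegative-resp-≈ (sym {recip (A * B)} (recip-* {A} {B} A₀ B₀)) (*-nonNegative 1/A≥0 1/B≥0)

1-b-nonNegativeReciprocal : ∀ {b} → b 0 ≡ 0ℤ → NonNegative b → NonNegativeReciprocal (1# - b)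
1-b-nonNegativeReciprocal {b} b₀ b≥0 =
  ≡.cong (λ x → 1ℤ ℤ.+ ℤ.- x) b₀ ,
  -- `recip (1# - b)` unfolds to sums of powers of `1# - (1# - b)`, which equals `b` only up to `≈`.
  λ n → geometric-nonNegative {1# - (1# - b)} (suc n)
    (nonNegative-resp-≈ (solve 1 (λ b → b := con 1ℤ :- (con 1ℤ :- b)) refl b) b≥0) n

product-nonNegativeReciprocal : ∀ {N} {f : Fin N → Series} →
  (∀ k → NonNegativeReciprocal (f k)) → NonNegativeReciprocal (product f)
product-nonNegativeReciprocal {zero}  _ =
  ≡.refl , nonNegative-resp-≈ (sym (trans (sym (*-identityˡ (recip 1#)))
    (recip-inverseʳ {1#} ≡.refl))) 1-nonNegative
product-nonNegativeReciprocal {suc N} {F} f =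
  *-nonNegativeReciprocal {F Fin.zero} {product (F ∘ Fin.suc)} (f Fin.zero)
    (product-nonNegativeReciprocal (f ∘ Fin.suc))

-- The constant coefficient of `recip A` computes to 1, and `1#` has no others.
recip⪰1 : ∀ {A} → NonNegativeReciprocal A → recip A ⪰ 1#
recip⪰1 (_ , 1/A≥0) zero    = ℤ.≤-refl
recip⪰1 (_ , 1/A≥0) (suc n) = ℤ.+-mono-≤ (1/A≥0 (suc n)) ℤ.≤-refl

regular : ∀ {A} → A 0 ≡ 1ℤ → Regular A
regular {A} A₀ X Y = *-cancelʳ {A} X Y A₀

*-constant-0ˡ : ∀ {A} B → A 0 ≡ 0ℤ → (A * B) 0 ≡ 0ℤ
*-constant-0ˡ B A₀ =
  ≡.trans (ℤ.+-identityʳ _) (≡.trans (≡.cong (ℤ._* B 0) A₀) (ℤ.*-zeroˡ (B 0)))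

1-b-constant : ∀ {b} → b 0 ≡ 0ℤ → (1# - b) 0 ≡ 1ℤ
1-b-constant b₀ = ≡.cong (λ x → 1ℤ ℤ.+ ℤ.- x) b₀

pochhammer-nonNegativeReciprocal : ∀ {a b} N → a 0 ≡ 0ℤ → NonNegative a → NonNegative b →
  NonNegativeReciprocal (pochhammer a b N)
pochhammer-nonNegativeReciprocal {a} {b} N a₀ a≥0 b≥0 = product-nonNegativeReciprocal {N}
  (λ k → 1-b-nonNegativeReciprocal {a * b ^ toℕ k} (*-constant-0ˡ {a} (b ^ toℕ k) a₀)
    (*-nonNegative a≥0 (^-nonNegative (toℕ k) b≥0)))

product-constant : ∀ N {f : Fin N → Series} → (∀ k → f k 0 ≡ 1ℤ) → product f 0 ≡ 1ℤ
product-constant zero        f₀ = ≡.refl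
product-constant (suc N) {f} f₀ =
  *-constant {f Fin.zero} {product (f ∘ Fin.suc)} (f₀ Fin.zero) (product-constant N (f₀ ∘ Fin.suc))

pochhammer-constant : ∀ b N → b 0 ≡ 0ℤ → pochhammer b b N 0 ≡ 1ℤ
pochhammer-constant b N b₀ = product-constant N
  (λ k → 1-b-constant {b * b ^ toℕ k} (*-constant-0ˡ {b} (b ^ toℕ k) b₀))

⪰-trans : ∀ {A B C} → A ⪰ B → B ⪰ C → A ⪰ C
⪰-trans {A} {B} {C} A⪰B B⪰C = nonNegative-resp-≈ {(A - B) + (B - C)}
  (solve 3 (λ A B C → (A :- B) :+ (B :- C) := A :- C) refl A B C)
  (+-nonNegative {A - B} {B - C} A⪰B B⪰C)

⪰-respˡ-≈ : ∀ {A B C} → A ≈ B → A ⪰ C → B ⪰ C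
⪰-respˡ-≈ {A} {B} {C} A≈B = nonNegative-resp-≈ {A - C} {B - C} (+-congʳ { - C} A≈B)

A/B⪰A : ∀ {A B} → NonNegative A → NonNegativeReciprocal B → A / B ⪰ A
A/B⪰A {A} {B} A≥0 1/B≥0 = nonNegative-resp-≈ {A * (recip B - 1#)}
  (solve 2 (λ A r → A :* (r :- con 1ℤ) := A :* r :- A) refl A (recip B))
  (*-nonNegative {A} {recip B - 1#} A≥0 (recip⪰1 1/B≥0))

-- Products for odd parts and for distinct parts

odd distinct : ℕ → Series
odd      = pochhammer q (q ^ 2)
distinct = pochhammer (- q) q

odd-nonNegativeReciprocal : ∀ N → NonNegativeReciprocal (odd N)
odd-nonNegativeReciprocal N =
  pochhammer-nonNegativeReciprocal N ≡.refl q-nonNegative (^-nonNegative 2 q-nonNegative)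

1/odd-nonNegative : ∀ N → NonNegative (1# / odd N)
1/odd-nonNegative N = *-nonNegative {1#} {recip (odd N)} 1-nonNegative
  (recip-nonNegative (odd-nonNegativeReciprocal N))

distinct-nonNegative : ∀ N → NonNegative (distinct N)
distinct-nonNegative N = product-nonNegative {N} (λ k → nonNegative-resp-≈ {1# + q * q ^ toℕ k}
  (solve 2 (λ q x → con 1ℤ :+ q :* x := con 1ℤ :- :- q :* x) refl q (q ^ toℕ k))
  (+-nonNegative {1#} {q * q ^ toℕ k} 1-nonNegative (^-nonNegative (suc (toℕ k)) q-nonNegative)))

-- 1/(q;q²)ₙ = (-q;q)ₙ / (qⁿ⁺¹;q)ₙ
1/odd⪰distinct : ∀ {n N} → n ℕ.≤′ N → 1# / odd N ⪰ distinct n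
1/odd⪰distinct {n} ℕ.≤′-refl = ⪰-respˡ-≈ {distinct n / T} {1# / odd n} {distinct n}
  (*-≈⇒≈-/ {odd n} (distinct n / T) (constant≡1 (odd-nonNegativeReciprocal n)) inverse)
  (A/B⪰A {distinct n} {T} (distinct-nonNegative n) T-recip)
  where
  T : Series
  T = pochhammer (q ^ suc n) q n

  T-recip : NonNegativeReciprocal T
  T-recip = pochhammer-nonNegativeReciprocal n ≡.refl (^-nonNegative (suc n) q-nonNegative) q-nonNegative

  inverse : distinct n / T * odd n ≈ 1#
  inverse = begin
    distinct n * recip T * odd n
      ≈⟨ solve 3 (λ E r O → E :* r :* O := E :* O :* r) refl (distinct n) (recip T) (odd n) ⟩
    distinct n * odd n * recip T
      ≈⟨ *-congʳ {recip T} (distinct*odd q (λ k → regular {1# - q ^ suc k} ≡.refl) n) ⟩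
    T * recip T
      ≈⟨ recip-inverseʳ {T} (constant≡1 T-recip) ⟩
    1#  ∎
-- One more odd factor 1 - q^(2N+1) in the denominator can only raise coefficients, by `A/B⪰A`.
1/odd⪰distinct {n} (ℕ.≤′-step {N} n≤′N) = ⪰-trans {1# / odd (suc N)} {X} {distinct n}
  (⪰-respˡ-≈ {X / factor} {1# / odd (suc N)} {X}
    (*-≈⇒≈-/ {odd (suc N)} (X / factor) (constant≡1 (odd-nonNegativeReciprocal (suc N))) inverse)
    (A/B⪰A {X} {factor} (1/odd-nonNegative N) factor-recip))
  (1/odd⪰distinct n≤′N)
  where
  X factor : Series
  X      = 1# / odd N
  factor = 1# - q * (q ^ 2) ^ N

  factor-recip : NonNegativeReciprocal factor
  factor-recip = 1-b-nonNegativeReciprocal {q * (q ^ 2) ^ N} (*-constant-0ˡ {q} ((q ^ 2) ^ N) ≡.refl)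
    (*-nonNegative q-nonNegative (^-nonNegative N (^-nonNegative 2 q-nonNegative)))

  inverse : X / factor * odd (suc N) ≈ 1#
  inverse = begin
    X / factor * odd (suc N)          ≈⟨ *-congˡ {X / factor} (poch-sucʳ q (q ^ 2) N) ⟩
    X / factor * (odd N * factor)
      ≈⟨ solve 3 (λ Y O f → Y :* (O :* f) := (Y :* f) :* O) refl (X / factor) (odd N) factor ⟩
    X / factor * factor * odd N       ≈⟨ *-congʳ {odd N} (/-*-cancel {factor} X (constant≡1 factor-recip)) ⟩
    X * odd N                         ≈⟨ /-*-cancel {odd N} 1# (constant≡1 (odd-nonNegativeReciprocal N)) ⟩
    1#                                ∎

-- The first factor of the odd product is 1 - q; cancelling it leaves the reciprocal of a product
-- that starts at q³.
1/odd*[1-q]-nonNegative : ∀ {N} → 1 ℕ.≤ N → NonNegative (1# / odd N * (1# - q))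
1/odd*[1-q]-nonNegative {suc N} _ = nonNegative-resp-≈ {1# / rest} {r * (1# - q)}
  (sym {r * (1# - q)} (*-≈⇒≈-/ {rest} (r * (1# - q)) (constant≡1 rest-recip) inverse))
  (*-nonNegative {1#} {recip rest} 1-nonNegative (recip-nonNegative rest-recip))
  where
  r rest : Series
  r    = 1# / odd (suc N)
  rest = pochhammer (q * q ^ 2) (q ^ 2) N

  rest-recip : NonNegativeReciprocal rest
  rest-recip = pochhammer-nonNegativeReciprocal N ≡.refl
    (^-nonNegative 3 q-nonNegative) (^-nonNegative 2 q-nonNegative)

  inverse : r * (1# - q) * rest ≈ 1#
  inverse = begin
    r * (1# - q) * rest        ≈⟨ *-assoc r (1# - q) rest ⟩
    r * ((1# - q) * rest)      ≈⟨ *-congˡ {r} (poch-sucˡ q (q ^ 2) N) ⟨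
    r * odd (suc N)            ≈⟨ /-*-cancel {odd (suc N)} 1# (constant≡1 (odd-nonNegativeReciprocal (suc N))) ⟩
    1#                         ∎

-- Decomposition of the bracket for power series

-- The upper index has the form `2 ℕ.+ n` so that the test and the subtraction in `gaussian`
-- compute, exposing the quotient.
gaussian-2 : ∀ {b} n → b 0 ≡ 0ℤ → Gaussian-2 b n (gaussian b (2 ℕ.+ n) 2)
gaussian-2 {b} n b₀ = quotient⇒Gaussian-2 {b} {n} {gaussian b (2 ℕ.+ n) 2}
  (regular {pochhammer b b n} (pochhammer-constant b n b₀))
  (/-*-cancel {pochhammer b b 2 * pochhammer b b n} (pochhammer b b (2 ℕ.+ n))
    (*-constant {pochhammer b b 2} {pochhammer b b n} (pochhammer-constant b 2 b₀) (pochhammer-constant b n b₀)))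

Q : Series
Q = q ^ 2

Q-nonNegative : NonNegative Q
Q-nonNegative = ^-nonNegative 2 q-nonNegative

-- `G-nonNegative` is included because the factorisation of `G` behind the decomposition also proves
-- it, and the summand qG(R - E) relies on it.
record BracketDecomposition (S G : Series) : Set where
  field
    K V           : Series
    K-nonNegative : NonNegative K
    V-nonNegative : NonNegative V
    G-nonNegative : NonNegative G
    decomposition : (S + q ^ 3 * G) - q * G ≈ K * (1# - q) + V

factored⇒bracketDecomposition : ∀ {S G Z} p e → NonNegative Z →
  G * ((1# - Q) * (1# - Q ^ 2)) ≈ (1# - (Q ^ 2) ^ p) * (1# - Q ^ e) →
  S * (1# - Q) ≈ (1# - (Q ^ 2) ^ p) + (1# - Q) * Z →
  BracketDecomposition S G
factored⇒bracketDecomposition {S} {G} {Z} p e Z≥0 G-eq S-eq = record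
  { K             = K
  ; V             = K * Q + Z + q * Q ^ e * K
  ; K-nonNegative = K≥0
  ; V-nonNegative =
      +-nonNegative {K * Q + Z} {q * Q ^ e * K}
        (+-nonNegative {K * Q} {Z} (*-nonNegative {K} {Q} K≥0 Q-nonNegative) Z≥0)
        (*-nonNegative {q * Q ^ e} {K}
          (*-nonNegative {q} {Q ^ e} q-nonNegative (^-nonNegative e Q-nonNegative)) K≥0)
  ; G-nonNegative = nonNegative-resp-≈ {K * B} {G} (sym {G} {K * B} G≈KB)
      (*-nonNegative {K} {B} K≥0 (geometric-nonNegative {Q} e Q-nonNegative))
  ; decomposition = bracket-decomposition {q} {(Q ^ 2) ^ p} {Q ^ e} {S} {G} {K} {B} {Z}
      (regular {1# - Q} ≡.refl) S-eq G≈KB ([1-b]*geometric (Q ^ 2) p) ([1-b]*geometric Q e)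
  }
  where
  K B : Series
  K = geometric (Q ^ 2) p
  B = geometric Q e

  K≥0 : NonNegative K
  K≥0 = geometric-nonNegative {Q ^ 2} p (^-nonNegative 2 Q-nonNegative)

  G≈KB : G ≈ K * B
  G≈KB = gaussian-factors {Q} {(Q ^ 2) ^ p} {Q ^ e} {G} {K} {B}
    (regular {(1# - Q) * (1# - Q ^ 2)} ≡.refl) G-eq ([1-b]*geometric (Q ^ 2) p) ([1-b]*geometric Q e)

Q^-even : ∀ p → Q ^ (p ℕ.* 2) ≈ (Q ^ 2) ^ p
Q^-even p = trans (^-congʳ Q (ℕ.*-comm p 2)) (sym {(Q ^ 2) ^ p} (^-assocʳ Q 2 p))

-- The even one of the exponents n+1 and n+2 makes 1 - Q² divide 1 - Qⁿ⁺¹ or 1 - Qⁿ⁺².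
bracketDecomposition : ∀ {S G} n → Gaussian-2 Q n G → S * (1# - Q) ≈ 1# - Q ^ (3 ℕ.+ n) →
  BracketDecomposition S G
bracketDecomposition {S} {G} n G-eq S-eq with n divMod 2
-- For n = 2p the even exponent is n + 2, so the two numerator factors are swapped. The exponent n +
-- 3 is one higher, whence Z = z.
... | result p Fin.zero ≡.refl = factored⇒bracketDecomposition {S} {G} {z} (suc p) (suc (p ℕ.* 2))
  (^-nonNegative (suc p) (^-nonNegative 2 Q-nonNegative))
  (begin
    G * ((1# - Q) * (1# - Q ^ 2))                       ≈⟨ G-eq ⟩
    (1# - Q ^ suc (p ℕ.* 2)) * (1# - Q ^ (suc p ℕ.* 2)) ≈⟨ *-comm (1# - Q ^ suc (p ℕ.* 2)) (1# - Q ^ (suc p ℕ.* 2)) ⟩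
    (1# - Q ^ (suc p ℕ.* 2)) * (1# - Q ^ suc (p ℕ.* 2))
      ≈⟨ *-congʳ {1# - Q ^ suc (p ℕ.* 2)} (1-cong (Q^-even (suc p))) ⟩
    (1# - z) * (1# - Q ^ suc (p ℕ.* 2))                 ∎)
  (begin
    S * (1# - Q)                      ≈⟨ S-eq ⟩
    1# - Q * Q ^ (suc p ℕ.* 2)        ≈⟨ 1-cong (*-congˡ {Q} (Q^-even (suc p))) ⟩
    1# - Q * z                        ≈⟨ 1-xz-expansion Q z ⟩
    (1# - z) + (1# - Q) * z           ∎)
  where
  z : Series
  z = (Q ^ 2) ^ suc p
-- For n = 2p + 1 the even exponent is n + 1. The exponent n + 3 is two higher, whence Z = (1 + Q)z.
... | result p (Fin.suc Fin.zero) ≡.refl = factored⇒bracketDecomposition {S} {G} {(1# + Q) * z} (suc p) (suc (suc p ℕ.* 2))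
  (*-nonNegative {1# + Q} {z} (+-nonNegative {1#} {Q} 1-nonNegative Q-nonNegative)
    (^-nonNegative (suc p) (^-nonNegative 2 Q-nonNegative)))
  (begin
    G * ((1# - Q) * (1# - Q ^ 2))     ≈⟨ G-eq ⟩
    (1# - Q ^ (suc p ℕ.* 2)) * (1# - Q ^ suc (suc p ℕ.* 2))
      ≈⟨ *-congʳ {1# - Q ^ suc (suc p ℕ.* 2)} (1-cong (Q^-even (suc p))) ⟩
    (1# - z) * (1# - Q ^ suc (suc p ℕ.* 2))                 ∎)
  (begin
    S * (1# - Q)                      ≈⟨ S-eq ⟩
    1# - Q * (Q * Q ^ (suc p ℕ.* 2))  ≈⟨ 1-cong (*-congˡ {Q} (*-congˡ {Q} (Q^-even (suc p)))) ⟩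
    1# - Q * (Q * z)                  ≈⟨ 1-xxz-expansion Q z ⟩
    (1# - z) + (1# - Q) * ((1# + Q) * z)  ∎)
  where
  z : Series
  z = (Q ^ 2) ^ suc p

-- The inequality

difference-nonNegative : ∀ {R S G H P E} → BracketDecomposition S G → H * P ≈ G * E →
  NonNegative R → NonNegative (R * (1# - q)) → R ⪰ E → R * (S + q ^ 3 * G) ⪰ q * H * P
difference-nonNegative {R} {S} {G} {H} {P} {E} bracketSG HP≈GE R≥0 R[1-q]≥0 R⪰E =
  nonNegative-resp-≈ {K * (R * (1# - q)) + R * V + q * G * (R - E)}
    (sym {R * (S + q ^ 3 * G) - q * H * P}
      (difference-decomposition {q} {R} {S} {G} {H} {P} {E} {K} {V} HP≈GE decomposition))
    (+-nonNegative {K * (R * (1# - q)) + R * V} {q * G * (R - E)}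
      (+-nonNegative {K * (R * (1# - q))} {R * V}
        (*-nonNegative {K} {R * (1# - q)} K-nonNegative R[1-q]≥0)
        (*-nonNegative {R} {V} R≥0 V-nonNegative))
      (*-nonNegative {q * G} {R - E} (*-nonNegative {q} {G} q-nonNegative G-nonNegative) R⪰E))
  where open BracketDecomposition bracketSG

-- The indices enter through equations so that matching on them removes the truncated subtractions
-- of the theorem.
bracketDecomposition-at : ∀ {L m n} → 4 ℕ.+ n ≡ L → 2 ℕ.+ n ≡ m →
  BracketDecomposition ((1# - q ^ (2 ℕ.* L ∸ 2)) / (1# - q ^ 2)) (gaussian (q ^ 2) m 2)
bracketDecomposition-at {L} {m} {n} ≡.refl ≡.refl =
  bracketDecomposition {S} {gaussian Q m 2} n (gaussian-2 {Q} n ≡.refl) S-eq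
  where
  S : Series
  S = (1# - q ^ (2 ℕ.* L ∸ 2)) / (1# - Q)

  S-eq : S * (1# - Q) ≈ 1# - Q ^ (3 ℕ.+ n)
  S-eq = begin
    S * (1# - Q)                ≈⟨ /-*-cancel {1# - Q} (1# - q ^ (2 ℕ.* L ∸ 2)) ≡.refl ⟩
    -- Once 2(4 + n) is written as 2 + 2(3 + n), the subtraction of 2 computes.
    1# - q ^ (2 ℕ.* L ∸ 2)      ≡⟨ ≡.cong (λ k → 1# - q ^ (k ∸ 2)) (ℕ.*-suc 2 (3 ℕ.+ n)) ⟩
    1# - q ^ (2 ℕ.* (3 ℕ.+ n))  ≈⟨ 1-cong (^-assocʳ q 2 (3 ℕ.+ n)) ⟨
    1# - Q ^ (3 ℕ.+ n)          ∎

gaussian*distinct-at : ∀ {m n} → 2 ℕ.+ n ≡ m →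
  gaussian q m 2 * pochhammer (- (q ^ 3)) q n ≈ gaussian (q ^ 2) m 2 * distinct n
gaussian*distinct-at {m} {n} ≡.refl = gaussian*distinct {q} {n} {gaussian q m 2} {gaussian Q m 2}
  (regular {(1# - Q) * (1# - Q ^ 2)} ≡.refl) (gaussian-2 {q} n ≡.refl) (gaussian-2 {Q} n ≡.refl)

corollary1p3 : (L : ℕ) → 4 ℕ.≤ L →
    (1# / pochhammer q (q ^ 2) L)
    * ((1# - q ^ (2 ℕ.* L ∸ 2)) / (1# - q ^ 2) + q ^ 3 * gaussian (q ^ 2) (L ∸ 2) 2)
    ⪰ q * gaussian q (L ∸ 2) 2 * pochhammer (- (q ^ 3)) q (L ∸ 4)
corollary1p3 L 4≤L = difference-nonNegative
  {1# / pochhammer q (q ^ 2) L} {(1# - q ^ (2 ℕ.* L ∸ 2)) / (1# - q ^ 2)}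
  {gaussian (q ^ 2) (L ∸ 2) 2} {gaussian q (L ∸ 2) 2}
  {pochhammer (- (q ^ 3)) q (L ∸ 4)} {distinct (L ∸ 4)}
  (bracketDecomposition-at 4+[L∸4]≡L 2+[L∸4]≡L∸2)
  (gaussian*distinct-at 2+[L∸4]≡L∸2)
  (1/odd-nonNegative L)
  (1/odd*[1-q]-nonNegative (ℕ.≤-trans (ℕ.s≤s ℕ.z≤n) 4≤L))
  (1/odd⪰distinct (ℕ.≤⇒≤′ (ℕ.m∸n≤m L 4)))
  where
  4+[L∸4]≡L : 4 ℕ.+ (L ∸ 4) ≡ L
  4+[L∸4]≡L = ℕ.m+[n∸m]≡n 4≤L

  2+[L∸4]≡L∸2 : 2 ℕ.+ (L ∸ 4) ≡ L ∸ 2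
  2+[L∸4]≡L∸2 = ≡.cong (_∸ 2) 4+[L∸4]≡L
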